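{- Let $A$ be a finite alphabet and let $w=\mu^{\omega}(a)$, where $a\in A$ and $\mu$ is an $r$-uniform morphism of $A^{\infty}$ (for some integer $r\ge 2$) that is prolongable on $a$. Suppose $w$ is aperiodic and uniformly recurrent. Then there is a constant $c$, depending only on $w$, such that for every positive integer $k$ and every index $i\ge 0$, there is a $k$-antipower with block length at most $ck$ starting at index $i$ of $w$.
   Context: Words are indexed from $0$: $w=w_0w_1w_2\cdots$. A morphism $\mu$ of $A^{\infty}=A^*\cup A^{\omega}$ satisfies $\mu(uv)=\mu(u)\mu(v)$ for $u$ finite, so it is determined by its values on letters; it is $r$-uniform if $|\mu(b)|=r$ for all $b\in A$, and prolongable on $a$ if $\mu(a)$ begins with $a$; then $\mu^{\omega}(a)$ is the infinite word having every $\mu^n(a)$ as a prefix. An infinite word is aperiodic if it has no periodic suffix. It is uniformly recurrent if for every integer $p$ there is an integer $q$ such that every length-$p$ substring (factor of consecutive letters) of $w$ occurs in every length-$q$ substring of $w$. A $k$-antipower with block length $b$ starting at index $i$ of $w$ means that the $k$ consecutive words $w_{i+jb}w_{i+jb+1}\cdots w_{i+(j+1)b-1}$, $j=0,1,\dots,k-1$, are pairwise distinct. -}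

module Defs where

open import Data.Nat using (ℕ; zero; suc; _+_; _*_; _^_; _≤_; _<_; _≥_)
open import Data.Nat.Properties using (^-monoʳ-≤)
open import Data.Fin using (Fin; fromℕ<)
open import Data.List using (List; []; _∷_; _++_; concatMap; length; lookup)
open import Data.Vec using (Vec; toList)
open import Data.Product using (Σ; ∃; _×_; _,_)
open import Relation.Binary.PropositionalEquality using (_≡_; _≢_)
open import Relation.Nullary using (¬_)

Word : ℕ → Set
Word n = ℕ → Fin n

-- A morphism of A^∞ is determined by its images of letters; it is
-- r-uniform iff every image has length r, so r-uniform morphisms are
-- given by maps Fin n → Vec (Fin n) r.
UniformMorphism : ℕ → ℕ → Set
UniformMorphism n r = Fin n → Vec (Fin n) r

applyM : ∀ {n r} → UniformMorphism n r → List (Fin n) → List (Fin n)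
applyM μ = concatMap (λ b → toList (μ b))

iterM : ∀ {n r} → UniformMorphism n r → ℕ → List (Fin n) → List (Fin n)
iterM μ zero u = u
iterM μ (suc k) u = applyM μ (iterM μ k u)

Prolongable : ∀ {n r} → UniformMorphism n r → Fin n → Set
Prolongable {n} μ a = Σ (List (Fin n)) λ u → toList (μ a) ≡ a ∷ u

-- w is μ^ω(a): every μ^k(a) is a prefix of w.
IsFixedPoint : ∀ {n r} → UniformMorphism n r → Fin n → Word n → Set
IsFixedPoint μ a w =
  ∀ (k m : ℕ) (lt : m Data.Nat.< length (iterM μ k (a ∷ []))) →
    w m ≡ lookup (iterM μ k (a ∷ [])) (fromℕ< lt)

Aperiodic : ∀ {n} → Word n → Set
Aperiodic w = ¬ (Σ ℕ λ s → Σ ℕ λ p → (1 ≤ p) × (∀ j → s ≤ j → w (j + p) ≡ w j))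

SameFactor : ∀ {n} → Word n → ℕ → ℕ → ℕ → Set
SameFactor w p i j = ∀ t → t < p → w (i + t) ≡ w (j + t)

UniformlyRecurrent : ∀ {n} → Word n → Set
UniformlyRecurrent w =
  ∀ (p : ℕ) → Σ ℕ λ q → ∀ (i j : ℕ) →
    Σ ℕ λ d → (d + p ≤ q) × SameFactor w p i (j + d)

IsAntipower : ∀ {n} → Word n → ℕ → ℕ → ℕ → Set
IsAntipower w k b i =
  ∀ j₁ j₂ → j₁ < k → j₂ < k → j₁ ≢ j₂ →
    ¬ SameFactor w b (i + j₁ * b) (i + j₂ * b)

{-# OPTIONS --safe #-}

-- Write N = r ^ m and call a match of C N letters between positions
-- N X + d and N Y an overlap of level m with offset d < N.  If a factor of
-- length C N recurred at a distance p ≤ N then, by uniform recurrence, the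
-- p-periodic window it spans would contain all factors of length p + 1 and w
-- would be p-periodic.  Hence the offset is determined by (X , Y) and m, and μ
-- turns an overlap (X , Y , d) into the overlap (X , Y , r d) of the next level.
-- Up to equality of factors there are finitely many pairs (X , Y), so at some
-- level M no new pair starts to overlap; cutting an overlap into r pieces shows
-- that none does later either.  Thus overlaps of level e + M have offset
-- divisible by r ^ e, so a long factor only recurs at distances divisible by
-- r ^ e.  With k ≤ r ^ e ≤ r k, a block length of order r ^ (e + M) that is
-- 1 modulo r ^ e gives an antipower.

module Submission where

open import Defs
open import Data.Nat using
  (ℕ; zero; suc; _+_; _*_; _^_; _∸_; _≤_; _<_; _≥_; z≤n; s≤s; NonZero; >-nonZero; >-nonZero⁻¹)
open import Data.Nat.Properties
open import Data.Nat.DivMod using (_/_; _%_; m≡m%n+[m/n]*n; m%n<n)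
open import Data.Nat.Divisibility using
  (_∣_; ∣⇒≤; 1∣_; m∣m*n; *-monoʳ-∣; ∣-trans; ∣m∣n⇒∣m+n; ∣m+n∣m⇒∣n)
open import Data.Nat.Induction using (<-wellFounded)
open import Data.Nat.Tactic.RingSolver using (solve-∀)
open import Data.Fin using (Fin; fromℕ<)
import Data.Fin.Properties as Fin
open import Data.List using (List; []; _∷_; _++_; length; lookup; filter; cartesianProduct; upTo)
open import Data.List.Properties using (filter-notAll; length-++)
open import Data.List.Membership.Propositional using (_∈_; lose)
open import Data.List.Membership.Propositional.Properties using
  (∈-filter⁺; ∈-cartesianProduct⁺; ∈-upTo⁺)
open import Data.List.Relation.Unary.Any as Any using (any?)
open import Data.Vec using (toList)
open import Data.Vec.Properties using (length-toList)
open import Data.Product using (Σ; ∃; ∃₂; _×_; _,_; proj₁; proj₂)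
open import Data.Unit using (⊤; tt)
open import Function using (_∘_)
open import Induction.WellFounded using (Acc; acc)
open import Relation.Binary.Definitions using (tri<; tri≈; tri>)
open import Relation.Binary.PropositionalEquality using
  (_≡_; _≢_; refl; sym; trans; cong; cong₂; subst; subst₂; module ≡-Reasoning)
open import Relation.Nullary using (¬_; yes; no; contradiction; ¬?; map′)
open import Relation.Unary using (Decidable)

-- Division with remainder and bounds on powers

divide : ∀ N .{{_ : NonZero N}} a → ∃₂ λ Q R → R < N × a ≡ N * Q + R
divide N a = a / N , a % N , m%n<n a N ,
  trans (m≡m%n+[m/n]*n a N) (trans (+-comm (a % N) _) (cong (_+ a % N) (*-comm (a / N) N)))

roundUp : ∀ N .{{_ : NonZero N}} a → ∃₂ λ s Q → s ≤ N × a + s ≡ N * Q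
roundUp N a with divide N a
... | Q , R , R<N , refl = N ∸ R , suc Q , m∸n≤m N R , (begin
  N * Q + R + (N ∸ R)   ≡⟨ +-assoc (N * Q) R _ ⟩
  N * Q + (R + (N ∸ R)) ≡⟨ cong (N * Q +_) (m+[n∸m]≡n (<⇒≤ R<N)) ⟩
  N * Q + N             ≡⟨ +-comm (N * Q) N ⟩
  N + N * Q             ≡⟨ *-suc N Q ⟨
  N * suc Q             ∎)
  where open ≡-Reasoning

block-bound : ∀ {N k τ σ} → τ < k → σ < N → N * τ + σ < N * k
block-bound {N} {k} {τ} {σ} τ<k σ<N = begin-strict
  N * τ + σ <⟨ +-monoʳ-< (N * τ) σ<N ⟩
  N * τ + N ≡⟨ +-comm (N * τ) N ⟩
  N + N * τ ≡⟨ *-suc N τ ⟨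
  N * suc τ ≤⟨ *-monoʳ-≤ N τ<k ⟩
  N * k     ∎
  where open ≤-Reasoning

divide-bounded : ∀ N .{{_ : NonZero N}} {k T} → T < N * k →
  ∃₂ λ τ σ → τ < k × σ < N × T ≡ N * τ + σ
divide-bounded N {k} {T} T<Nk with divide N T
... | τ , σ , σ<N , refl =
  τ , σ , *-cancelˡ-< N τ k (≤-<-trans (m≤m+n (N * τ) σ) T<Nk) , σ<N , refl

n<r^n : ∀ {r} → r ≥ 2 → ∀ n → n < r ^ n
n<r^n r≥2 zero = s≤s z≤n
n<r^n {r} r≥2 (suc n) = begin-strict
  suc n         ≤⟨ n<r^n r≥2 n ⟩
  r ^ n         <⟨ m<m+n (r ^ n) (≤-trans (s≤s z≤n) (n<r^n r≥2 n)) ⟩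
  r ^ n + r ^ n ≡⟨ cong (r ^ n +_) (+-identityʳ (r ^ n)) ⟨
  2 * r ^ n     ≤⟨ *-monoˡ-≤ (r ^ n) r≥2 ⟩
  r * r ^ n     ∎
  where open ≤-Reasoning

power-between : ∀ {r} → r ≥ 2 → ∀ k → ∃ λ e → suc k ≤ r ^ e × r ^ e ≤ r * suc k
power-between {r} r≥2 zero = 0 , ≤-refl , subst (1 ≤_) (sym (*-identityʳ r)) (<⇒≤ r≥2)
power-between {r} r≥2 (suc k) with power-between r≥2 k
... | e , k<rᵉ , rᵉ≤rk with suc (suc k) ≤? r ^ e
...   | yes k+2≤rᵉ = e , k+2≤rᵉ , ≤-trans rᵉ≤rk (*-monoʳ-≤ r (n≤1+n (suc k)))
...   | no k+2≰rᵉ = suc e , lower , *-monoʳ-≤ r (≤-trans rᵉ≤k+1 (n≤1+n (suc k)))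
  where
  rᵉ≤k+1 : r ^ e ≤ suc k
  rᵉ≤k+1 = ≤-pred (≰⇒> k+2≰rᵉ)
  lower : suc (suc k) ≤ r * r ^ e
  lower = begin
    1 + suc k         ≤⟨ +-monoˡ-≤ (suc k) (s≤s z≤n) ⟩
    suc k + suc k     ≤⟨ +-mono-≤ k<rᵉ k<rᵉ ⟩
    r ^ e + r ^ e     ≡⟨ cong (r ^ e +_) (+-identityʳ (r ^ e)) ⟨
    2 * r ^ e         ≤⟨ *-monoˡ-≤ (r ^ e) r≥2 ⟩
    r * r ^ e         ∎
    where open ≤-Reasoning

-- Stabilisation of an increasing family on a finite list

module _ {A : Set} (B : ℕ → A → Set) (B? : ∀ m → Decidable (B m)) where

  -- The list `ys` contains every element still outside `B m`. If some member of `ys` lies in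
  -- `B (suc m)`, filtering shortens `ys`; otherwise nothing enters at this step and `m` serves as
  -- `M`.
  stabilises : (∀ {m z} → B m z → B (suc m) z) → ∀ zs →
    ∃ λ M → ∀ {z} → z ∈ zs → B (suc M) z → B M z
  stabilises mono zs = go zs 0 (λ z∈zs _ → z∈zs) (<-wellFounded (length zs))
    where
    go : ∀ ys m → (∀ {z} → z ∈ zs → ¬ B m z → z ∈ ys) → Acc _<_ (length ys) →
      ∃ λ M → ∀ {z} → z ∈ zs → B (suc M) z → B M z
    go ys m ys⊇ (acc rec) with any? (B? (suc m)) ys
    ... | yes new = go (filter (¬? ∘ B? (suc m)) ys) (suc m)
          (λ z∈zs ¬B → ∈-filter⁺ (¬? ∘ B? (suc m)) (ys⊇ z∈zs (¬B ∘ mono)) ¬B)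
          (rec (filter-notAll (¬? ∘ B? (suc m)) ys (Any.map (λ b ¬b → ¬b b) new)))
    ... | no none = m , old
          where
          old : ∀ {z} → z ∈ zs → B (suc m) z → B m z
          old {z} z∈zs b with B? m z
          ... | yes b′ = b′
          ... | no ¬b = contradiction (lose (ys⊇ z∈zs ¬b) b) none

-- Prefixes of infinite words and images under uniform morphisms

Prefix : {A : Set} → List A → (ℕ → A) → Set
Prefix []       f = ⊤
Prefix (x ∷ xs) f = f 0 ≡ x × Prefix xs (f ∘ suc)

module _ {A : Set} where

  lookup⇒Prefix : (xs : List A) (f : ℕ → A) →
    (∀ m (m< : m < length xs) → f m ≡ lookup xs (fromℕ< m<)) → Prefix xs f
  lookup⇒Prefix [] f eq = tt
  lookup⇒Prefix (x ∷ xs) f eq =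
    eq 0 (s≤s z≤n) , lookup⇒Prefix xs (f ∘ suc) (λ m m< → eq (suc m) (s≤s m<))

  Prefix-unique : (xs : List A) {f g : ℕ → A} → Prefix xs f → Prefix xs g →
    ∀ t → t < length xs → f t ≡ g t
  Prefix-unique (x ∷ xs) (f0 , fs) (g0 , gs) zero _ = trans f0 (sym g0)
  Prefix-unique (x ∷ xs) (f0 , fs) (g0 , gs) (suc t) (s≤s t<) = Prefix-unique xs fs gs t t<

  Prefix-resp : (xs : List A) {f g : ℕ → A} → (∀ t → f t ≡ g t) → Prefix xs f → Prefix xs g
  Prefix-resp [] f≗g p = tt
  Prefix-resp (x ∷ xs) f≗g (f0 , fs) =
    trans (sym (f≗g 0)) f0 , Prefix-resp xs (f≗g ∘ suc) fs

  Prefix-++⁻ : (xs : List A) {ys : List A} {f : ℕ → A} → Prefix (xs ++ ys) f →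
    Prefix xs f × Prefix ys (λ t → f (length xs + t))
  Prefix-++⁻ [] p = tt , p
  Prefix-++⁻ (x ∷ xs) (f0 , fs) with Prefix-++⁻ xs fs
  ... | pxs , pys = (f0 , pxs) , pys

module _ {n r : ℕ} (μ : UniformMorphism n r) where

  applyM-block : ∀ u {f g : Word n} → Prefix u f → Prefix (applyM μ u) g →
    ∀ x → x < length u → Prefix (toList (μ (f x))) (λ t → g (x * r + t))
  applyM-block (c ∷ u) {f} {g} (refl , fs) gs zero _ = proj₁ (Prefix-++⁻ (toList (μ c)) gs)
  applyM-block (c ∷ u) {f} {g} (refl , fs) gs (suc x) (s≤s x<) =
    Prefix-resp (toList (μ (f (suc x)))) (λ t → cong g (sym (+-assoc r (x * r) t)))
      (applyM-block u fs gs′ x x<)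
    where
    gs′ : Prefix (applyM μ u) (λ t → g (r + t))
    gs′ = subst (λ l → Prefix (applyM μ u) (λ t → g (l + t))) (length-toList (μ c))
            (proj₂ (Prefix-++⁻ (toList (μ c)) gs))

  length-applyM : ∀ u → length (applyM μ u) ≡ length u * r
  length-applyM [] = refl
  length-applyM (c ∷ u) = begin
    length (toList (μ c) ++ applyM μ u)           ≡⟨ length-++ (toList (μ c)) ⟩
    length (toList (μ c)) + length (applyM μ u)   ≡⟨ cong₂ _+_ (length-toList (μ c)) (length-applyM u) ⟩
    r + length u * r ∎
    where
    open ≡-Reasoning

  length-iterM : ∀ a k → length (iterM μ k (a ∷ [])) ≡ r ^ k
  length-iterM a zero = refl
  length-iterM a (suc k) = begin
    length (iterM μ (suc k) (a ∷ []))  ≡⟨ length-applyM (iterM μ k (a ∷ [])) ⟩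
    length (iterM μ k (a ∷ [])) * r    ≡⟨ cong (_* r) (length-iterM a k) ⟩
    r ^ k * r                          ≡⟨ *-comm (r ^ k) r ⟩
    r ^ suc k                          ∎
    where open ≡-Reasoning

-- The trace of `w = μ(w)` on positions. Being a property of `w` alone, it passes from `r` to all
-- powers `r ^ m`.
Inflates : ∀ {n} → Word n → ℕ → Set
Inflates w N = ∀ x y → w x ≡ w y → SameFactor w N (N * x) (N * y)

fixedPoint⇒Inflates : ∀ {n r} → r ≥ 2 → (μ : UniformMorphism n r) (a : Fin n) (w : Word n) →
  IsFixedPoint μ a w → Inflates w r
fixedPoint⇒Inflates {n} {r} r≥2 μ a w fix x y wx≡wy t t<r =
  subst₂ (λ x′ y′ → w (x′ + t) ≡ w (y′ + t)) (*-comm x r) (*-comm y r)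
    (Prefix-unique (toList (μ (w x))) (block x)
      (subst (λ c → Prefix (toList (μ c)) (λ s → w (y * r + s))) (sym wx≡wy) (block y))
      t (subst (t <_) (sym (length-toList (μ (w x)))) t<r))
  where
  prefix : ∀ k → Prefix (iterM μ k (a ∷ [])) w
  prefix k = lookup⇒Prefix (iterM μ k (a ∷ [])) w (fix k)
  block : ∀ z → Prefix (toList (μ (w z))) (λ s → w (z * r + s))
  -- Since `z < r ^ z`, the letter at `z` already lies in the `z`-th iterate, and its image lies in
  -- the next one.
  block z = applyM-block μ (iterM μ z (a ∷ [])) (prefix z) (prefix (suc z)) z
    (subst (z <_) (sym (length-iterM μ a z)) (n<r^n r≥2 z))

module _ {n : ℕ} {w : Word n} where

  SameFactor-inflate : ∀ {N} .{{_ : NonZero N}} → Inflates w N →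
    ∀ {k x y} → SameFactor w k x y → SameFactor w (N * k) (N * x) (N * y)
  SameFactor-inflate {N} inf {k} {x} {y} same T T<Nk with divide-bounded N T<Nk
  ... | τ , σ , τ<k , σ<N , refl = begin
    w (N * x + (N * τ + σ)) ≡⟨ cong w (regroup N x τ σ) ⟩
    w (N * (x + τ) + σ)     ≡⟨ inf (x + τ) (y + τ) (same τ τ<k) σ σ<N ⟩
    w (N * (y + τ) + σ)     ≡⟨ cong w (regroup N y τ σ) ⟨
    w (N * y + (N * τ + σ)) ∎
    where
    open ≡-Reasoning
    regroup : ∀ N x τ σ → N * x + (N * τ + σ) ≡ N * (x + τ) + σ
    regroup = solve-∀

  Inflates-* : ∀ {N r} .{{_ : NonZero r}} → Inflates w N → Inflates w r → Inflates w (r * N)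
  Inflates-* {N} {r} infN infr x y wx≡wy =
    subst₂ (SameFactor w (r * N)) (sym (*-assoc r N x)) (sym (*-assoc r N y))
      (SameFactor-inflate infr (infN x y wx≡wy))

  Inflates-^ : ∀ {r} .{{_ : NonZero r}} → Inflates w r → ∀ m → Inflates w (r ^ m)
  Inflates-^ inf zero x y wx≡wy zero t<1 = subst₂ (λ x′ y′ → w x′ ≡ w y′) (1*x+0 x) (1*x+0 y) wx≡wy
    where
    1*x+0 : ∀ x → x ≡ 1 * x + 0
    1*x+0 = solve-∀
  Inflates-^ inf zero x y wx≡wy (suc t) (s≤s ())
  Inflates-^ inf (suc m) = Inflates-* (Inflates-^ inf m) inf

-- Antipowers from divisible return distances

-- Equal blocks with indices differing by `D` give a return at distance `D * b`. As `b` is 1 modulo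
-- `N`, this makes `N` divide `D`, impossible for `0 < D < k ≤ N`.
antipower-from-returns : ∀ {n} {w : Word n} {N K k b} → b ≡ N * K + 1 → k ≤ N →
  (∀ i D → SameFactor w b (i + D) i → N ∣ D) → ∀ i → IsAntipower w k b i
antipower-from-returns {w = w} {N} {K} {k} {b} b≡ k≤N N∣returns i = distinct
  where
  split : ∀ i j D b → i + j * b + D * b ≡ i + (j + D) * b
  split = solve-∀
  expand : ∀ D N K → D * (N * K + 1) ≡ N * (K * D) + D
  expand = solve-∀

  ordered : ∀ {j₁ j₂} → j₁ < j₂ → j₂ < k → ¬ SameFactor w b (i + j₂ * b) (i + j₁ * b)
  ordered {j₁} {j₂} j₁<j₂ j₂<k same =
    <⇒≱ (≤-<-trans (m∸n≤m j₂ j₁) (≤-trans j₂<k k≤N))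
      (∣⇒≤ {{>-nonZero (m<n⇒0<n∸m j₁<j₂)}} N∣D)
    where
    D = j₂ ∸ j₁
    position : i + j₂ * b ≡ i + j₁ * b + D * b
    position = trans (cong (λ j → i + j * b) (sym (m+[n∸m]≡n (<⇒≤ j₁<j₂)))) (sym (split i j₁ D b))
    N∣Db : N ∣ D * b
    N∣Db = N∣returns (i + j₁ * b) (D * b)
      (subst (λ v → SameFactor w b v (i + j₁ * b)) position same)
    N∣D : N ∣ D
    N∣D = ∣m+n∣m⇒∣n
      (subst (N ∣_) (trans (cong (D *_) b≡) (expand D N K)) N∣Db) (m∣m*n (K * D))

  distinct : IsAntipower w k b i
  distinct j₁ j₂ j₁<k j₂<k j₁≢j₂ same with <-cmp j₁ j₂
  ... | tri< j₁<j₂ _ _ = ordered j₁<j₂ j₂<k (λ t t< → sym (same t t<))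
  ... | tri≈ _ j₁≡j₂ _ = j₁≢j₂ j₁≡j₂
  ... | tri> _ _ j₂<j₁ = ordered j₂<j₁ j₁<k same

linear-antipowers : ∀ {n r} {w : Word n} K → r ≥ 2 →
  (∀ e i D → SameFactor w (r ^ e * K) (i + D) i → r ^ e ∣ D) →
  ∃ λ c → ∀ k i → k ≥ 1 → ∃ λ b → 1 ≤ b × b ≤ c * k × IsAntipower w k b i
linear-antipowers {r = r} {w} K r≥2 r^e∣returns = r * K + 1 , antipower
  where
  antipower : ∀ k i → k ≥ 1 → ∃ λ b → 1 ≤ b × b ≤ (r * K + 1) * k × IsAntipower w k b i
  antipower (suc k) i _ with power-between r≥2 k
  ... | e , k≤rᵉ , rᵉ≤rk = r ^ e * K + 1 , m≤n+m 1 _ , bound ,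
        antipower-from-returns {w = w} {K = K} refl k≤rᵉ
          (λ i D same → r^e∣returns e i D λ t t< → same t (≤-trans t< (m≤m+n _ 1))) i
    where
    regroup : ∀ r k K → r * k * K + k ≡ (r * K + 1) * k
    regroup = solve-∀
    -- The 1 that fixes the residue of the block length is absorbed by one copy of `suc k`; hence
    -- the constant `r * K + 1`.
    bound : r ^ e * K + 1 ≤ (r * K + 1) * suc k
    bound = ≤-trans (+-mono-≤ (*-monoˡ-≤ K rᵉ≤rk) (s≤s z≤n)) (≤-reflexive (regroup r (suc k) K))

-- Long factors have no short returns

module _ {n : ℕ} {w : Word n} (aper : Aperiodic w) (rec : UniformlyRecurrent w) where

  private
    q = proj₁ (rec 2)

  -- Any two positions at distance `p ≤ N` lie within two consecutive blocks of length `N`. These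
  -- are the inflation of a pair of letters, which recurs within `q` letters, so a copy of both
  -- positions falls where `same` applies. Thus `w` would have period `p` from the start.
  no-short-return : ∀ {N C} .{{_ : NonZero N}} → Inflates w N → q ≤ C →
    ∀ u p → 1 ≤ p → p ≤ N → ¬ SameFactor w (C * N) u (u + p)
  no-short-return {N} {C} inf q≤C u p 1≤p p≤N same = aper (0 , p , 1≤p , λ i _ → periodic i)
    where
    periodic : ∀ i → w (i + p) ≡ w i
    periodic i with divide N i | roundUp N u
    ... | X , s , s<N , refl | s′ , J , s′≤N , u+s′≡NJ with proj₂ (rec 2) X J
    ...   | d , d+2≤q , same₂ = begin
      w (N * X + s + p)                    ≡⟨ cong w (+-assoc (N * X) s p) ⟩
      w (N * X + (s + p))                  ≡⟨ pair (s + p) (+-mono-<-≤ s<N p≤N) ⟩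
      w (N * (J + d) + (s + p))            ≡⟨ cong w (+-assoc (N * (J + d)) s p) ⟨
      w (N * (J + d) + s + p)              ≡⟨ cong (λ v → w (v + p)) pos ⟩
      w (u + t + p)                        ≡⟨ cong w (+-swap u t p) ⟩
      w (u + p + t)                        ≡⟨ same t t< ⟨
      w (u + t)                            ≡⟨ cong w pos ⟨
      w (N * (J + d) + s)                  ≡⟨ pair s (m≤n⇒m≤n+o N s<N) ⟨
      w (N * X + s)                        ∎
      where
      open ≡-Reasoning
      t = s′ + (N * d + s)
      +-swap : ∀ a b c → a + b + c ≡ a + c + b
      +-swap = solve-∀
      double : ∀ N → N + N ≡ N * 2
      double = solve-∀
      pair : ∀ T → T < N + N → w (N * X + T) ≡ w (N * (J + d) + T)
      pair T T< = SameFactor-inflate inf {2} {X} {J + d} same₂ T (subst (T <_) (double N) T<)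
      pos : N * (J + d) + s ≡ u + t
      pos = begin
        N * (J + d) + s        ≡⟨ regroup N J d s ⟩
        N * J + (N * d + s)    ≡⟨ cong (_+ (N * d + s)) u+s′≡NJ ⟨
        u + s′ + (N * d + s)   ≡⟨ +-assoc u s′ _ ⟩
        u + t                  ∎
        where
        regroup : ∀ N J d s → N * (J + d) + s ≡ N * J + (N * d + s)
        regroup = solve-∀
      -- At most one block to round `u` up to a multiple of `N`, then `d` blocks to the recurring
      -- pair, and part of a block for `s`.
      t< : t < C * N
      t< = ≤-trans (+-mono-≤-< s′≤N (+-monoʳ-< (N * d) s<N))
        (≤-trans (≤-reflexive (sum N d)) (*-monoˡ-≤ N (≤-trans d+2≤q q≤C)))
        where
        sum : ∀ N d → N + (N * d + N) ≡ (d + 2) * N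
        sum = solve-∀

  -- Overlaps: inflation, transfer and uniqueness of offsets

  module _ {r C : ℕ} .{{r≢0 : NonZero r}} .{{C≢0 : NonZero C}} (q≤C : q ≤ C)
    (inf : Inflates w r) where

    private
      r^m≢0 : ∀ m → NonZero (r ^ m)
      r^m≢0 m = m^n≢0 r m

    -- Only the first position carries an offset, because any slightly longer match can be shifted
    -- until its second position is a multiple of `N`.
    Overlap : ℕ → ℕ → ℕ → ℕ → Set
    Overlap N X Y d = SameFactor w (C * N) (N * X + d) (N * Y)

    Overlaps : ℕ → ℕ × ℕ → Set
    Overlaps m (X , Y) = ∃ λ d → d < r ^ m × Overlap (r ^ m) X Y d

    Overlaps? : ∀ m → Decidable (Overlaps m)
    Overlaps? m (X , Y) = anyUpTo? overlap? (r ^ m)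
      where
      overlap? : Decidable (Overlap (r ^ m) X Y)
      overlap? d = map′ (λ h t t< → h t<) (λ h {t} t< → h t t<)
        (allUpTo? (λ t → w (r ^ m * X + d + t) Fin.≟ w (r ^ m * Y + t)) (C * r ^ m))

    Overlap-inflate : ∀ {N X Y d} → Overlap N X Y d → Overlap (r * N) X Y (r * d)
    Overlap-inflate {N} {X} {Y} {d} o T T< =
      subst₂ (λ x y → w (x + T) ≡ w (y + T)) (left r N X d) (sym (*-assoc r N Y))
        (SameFactor-inflate inf o T (subst (T <_) (size r N C) T<))
      where
      left : ∀ r N X d → r * (N * X + d) ≡ r * N * X + r * d
      left = solve-∀
      size : ∀ r N C → C * (r * N) ≡ r * (C * N)
      size = solve-∀

    Overlaps-suc : ∀ {m z} → Overlaps m z → Overlaps (suc m) z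
    Overlaps-suc {m} (d , d< , o) = r * d , *-monoʳ-< r d< , Overlap-inflate o

    -- With `d < N`, the `C * N` letters compared on either side stay inside `suc C` blocks. Only
    -- the factors of length `suc C` at `X` and `Y` matter, which leaves finitely many cases.
    Overlap-transfer : ∀ {N X Y X′ Y′ d} .{{_ : NonZero N}} → Inflates w N → d < N →
      SameFactor w (suc C) X X′ → SameFactor w (suc C) Y Y′ → Overlap N X Y d → Overlap N X′ Y′ d
    Overlap-transfer {N} {X} {Y} {X′} {Y′} {d} infN d<N sX sY o T T< = begin
      w (N * X′ + d + T)     ≡⟨ cong w (+-assoc (N * X′) d T) ⟩
      w (N * X′ + (d + T))   ≡⟨ SameFactor-inflate infN {suc C} {X} {X′} sX (d + T) d+T< ⟨
      w (N * X + (d + T))    ≡⟨ cong w (+-assoc (N * X) d T) ⟨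
      w (N * X + d + T)      ≡⟨ o T T< ⟩
      w (N * Y + T)          ≡⟨ SameFactor-inflate infN {suc C} {Y} {Y′} sY T (≤-<-trans (m≤n+m T d) d+T<) ⟩
      w (N * Y′ + T)         ∎
      where
      open ≡-Reasoning
      d+T< : d + T < N * suc C
      d+T< = subst (d + T <_) (*-comm (suc C) N) (+-mono-< d<N T<)

    -- The factor at `N * Y` would also stand at both offsets, hence return at distance
    -- `d′ ∸ d ≤ N`.
    offset-≮ : ∀ {N X Y d d′} .{{_ : NonZero N}} → Inflates w N → d < d′ → d′ < N →
      Overlap N X Y d → ¬ Overlap N X Y d′
    offset-≮ {N} {X} {Y} {d} {d′} infN d<d′ d′<N o o′ =
      no-short-return infN q≤C (N * X + d) (d′ ∸ d) (m<n⇒0<n∸m d<d′)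
        (≤-trans (m∸n≤m d′ d) (<⇒≤ d′<N)) same
      where
      shift : N * X + d + (d′ ∸ d) ≡ N * X + d′
      shift = trans (+-assoc (N * X) d _) (cong (N * X +_) (m+[n∸m]≡n (<⇒≤ d<d′)))
      same : SameFactor w (C * N) (N * X + d) (N * X + d + (d′ ∸ d))
      same T T< = trans (o T T<) (trans (sym (o′ T T<)) (cong (λ v → w (v + T)) (sym shift)))

    offset-unique : ∀ {N X Y d d′} .{{_ : NonZero N}} → Inflates w N → d < N → d′ < N →
      Overlap N X Y d → Overlap N X Y d′ → d ≡ d′
    offset-unique {N} {X} {Y} {d} {d′} infN d<N d′<N o o′ with <-cmp d d′
    ... | tri< d<d′ _ _ = contradiction o′ (offset-≮ {X = X} {Y} infN d<d′ d′<N o)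
    ... | tri≈ _ d≡d′ _ = d≡d′
    ... | tri> _ _ d′<d = contradiction o (offset-≮ {X = X} {Y} infN d′<d d<N o′)

    -- Desubstitution of overlaps

    -- A converse to `Overlap-inflate`, with the same pair `X`, `Y` at both levels.
    Desubstitutes : ℕ → Set
    Desubstitutes N = ∀ X Y d → d < r * N → Overlap (r * N) X Y d →
      ∃ λ δ → d ≡ r * δ × Overlap N X Y δ

    -- Piece `α` starts `C * α` blocks of length `N` further on. The `e` whole blocks of the offset
    -- go into the block index, so all pieces keep the same remaining offset `d`.
    Overlap-cut : ∀ {N X Y e d} → Overlap (r * N) X Y (N * e + d) →
      ∀ {α} → α < r → Overlap N (r * X + e + C * α) (r * Y + C * α) d
    Overlap-cut {N} {X} {Y} {e} {d} o {α} α<r T T< = begin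
      w (N * (r * X + e + C * α) + d + T)               ≡⟨ cong w (left r N X e C α d T) ⟩
      w (r * N * X + (N * e + d) + (C * N * α + T))     ≡⟨ o (C * N * α + T) T′< ⟩
      w (r * N * Y + (C * N * α + T))                   ≡⟨ cong w (right r N Y C α T) ⟨
      w (N * (r * Y + C * α) + T)                       ∎
      where
      open ≡-Reasoning
      left : ∀ r N X e C α d T →
        N * (r * X + e + C * α) + d + T ≡ r * N * X + (N * e + d) + (C * N * α + T)
      left = solve-∀
      right : ∀ r N Y C α T → N * (r * Y + C * α) + T ≡ r * N * Y + (C * N * α + T)
      right = solve-∀
      size : ∀ r N C → C * N * r ≡ C * (r * N)
      size = solve-∀
      T′< : C * N * α + T < C * (r * N)
      T′< = subst (C * N * α + T <_) (size r N C) (block-bound α<r T<)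

    Overlap-glue : ∀ {N X Y e d} .{{_ : NonZero N}} →
      (∀ {α} → α < r → Overlap N (r * X + e + C * α) (r * Y + C * α) d) →
      Overlap (r * N) X Y (N * e + d)
    Overlap-glue {N} {X} {Y} {e} {d} pieces T T<
      with divide-bounded (C * N) {{m*n≢0 C N}} (subst (T <_) (size r N C) T<)
      where
      size : ∀ r N C → C * (r * N) ≡ C * N * r
      size = solve-∀
    ... | α , β , α<r , β< , refl = begin
      w (r * N * X + (N * e + d) + (C * N * α + β))  ≡⟨ cong w (left r N X e C α d β) ⟩
      w (N * (r * X + e + C * α) + d + β)            ≡⟨ pieces α<r β β< ⟩
      w (N * (r * Y + C * α) + β)                    ≡⟨ cong w (right r N Y C α β) ⟩
      w (r * N * Y + (C * N * α + β))                ∎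
      where
      open ≡-Reasoning
      left : ∀ r N X e C α d β →
        r * N * X + (N * e + d) + (C * N * α + β) ≡ N * (r * X + e + C * α) + d + β
      left = solve-∀
      right : ∀ r N Y C α β → N * (r * Y + C * α) + β ≡ r * N * Y + (C * N * α + β)
      right = solve-∀

    -- An overlap of length C (r (r N)) is cut into r pieces of length C (r N); the
    -- pieces share their offset d′, so their desubstitutions fit together.
    Desubstitutes-suc : ∀ {N} .{{_ : NonZero N}} → Desubstitutes N → Desubstitutes (r * N)
    Desubstitutes-suc {N} desub X Y d d< o with divide (r * N) {{m*n≢0 r N}} d
    ... | e , d′ , d′< , refl =
      N * e + δ , offset , Overlap-glue {N} {X} {Y} {e} {δ} pieces
      where
      desubPiece : ∀ {α} → α < r →
        ∃ λ δ → d′ ≡ r * δ × Overlap N (r * X + e + C * α) (r * Y + C * α) δ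
      desubPiece {α} α<r = desub (r * X + e + C * α) (r * Y + C * α) d′ d′<
        (Overlap-cut {r * N} {X} {Y} {e} {d′} o α<r)

      firstPiece : ∃ λ δ → d′ ≡ r * δ × Overlap N (r * X + e + C * 0) (r * Y + C * 0) δ
      firstPiece = desubPiece (>-nonZero⁻¹ r)

      δ : ℕ
      δ = proj₁ firstPiece

      d′≡rδ : d′ ≡ r * δ
      d′≡rδ = proj₁ (proj₂ firstPiece)

      factor : ∀ r N e δ → r * N * e + r * δ ≡ r * (N * e + δ)
      factor = solve-∀

      offset : r * N * e + d′ ≡ r * (N * e + δ)
      offset = trans (cong (r * N * e +_) d′≡rδ) (factor r N e δ)

      pieces : ∀ {α} → α < r → Overlap N (r * X + e + C * α) (r * Y + C * α) δ
      pieces {α} α<r = let δ′ , d′≡rδ′ , o′ = desubPiece α<r in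
        subst (Overlap N (r * X + e + C * α) (r * Y + C * α))
          (*-cancelˡ-≡ δ′ δ r (trans (sym d′≡rδ′) d′≡rδ)) o′

    -- An overlap of level `suc M` is moved to representatives below `Q`, where by the choice of `M`
    -- the pair already overlaps at level `M`, and that overlap is moved back.
    eventually-desubstitutes : ∃ λ M → Desubstitutes (r ^ M)
    eventually-desubstitutes with rec (suc C)
    ... | Q , occurs with stabilises Overlaps Overlaps? (λ {m} {z} → Overlaps-suc {m} {z})
                            (cartesianProduct (upTo Q) (upTo Q))
    ...   | M , stable = M , desub
      where
      early : ∀ X → ∃ λ X′ → X′ < Q × SameFactor w (suc C) X X′
      -- The window starting at 0 gives each factor of length `suc C` a representative below `Q`.
      early X with occurs X 0
      ... | X′ , X′+p≤Q , same = X′ , ≤-trans (m<m+n X′ (s≤s z≤n)) X′+p≤Q , same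

      SameFactor-sym : ∀ {p i j} → SameFactor w p i j → SameFactor w p j i
      SameFactor-sym same t t< = sym (same t t<)

      desub : Desubstitutes (r ^ M)
      desub X Y d d< o with early X | early Y
      ... | X′ , X′<Q , sX | Y′ , Y′<Q , sY
        with stable (∈-cartesianProduct⁺ (∈-upTo⁺ X′<Q) (∈-upTo⁺ Y′<Q))
               (d , d< , Overlap-transfer {r ^ suc M} {X} {Y} {X′} {Y′} {{r^m≢0 (suc M)}}
                           (Inflates-^ inf (suc M)) d< sX sY o)
      ...   | δ , δ< , o′ = δ , d≡rδ , o″
        where
        o″ : Overlap (r ^ M) X Y δ
        o″ = Overlap-transfer {r ^ M} {X′} {Y′} {X} {Y} {{r^m≢0 M}} (Inflates-^ inf M) δ<
               (SameFactor-sym {_} {X} {X′} sX) (SameFactor-sym {_} {Y} {Y′} sY) o′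
        -- Inflating the overlap found at level `M` gives a second overlap of the original pair at
        -- level `suc M`, and offsets are unique.
        d≡rδ : d ≡ r * δ
        d≡rδ = offset-unique {r ^ suc M} {X} {Y} {{r^m≢0 (suc M)}} (Inflates-^ inf (suc M)) d<
                 (*-monoʳ-< r δ<) o (Overlap-inflate {r ^ M} {X} {Y} o″)

    -- Divisibility of return distances

    -- The match has `N` letters more than an overlap; they pay for the shift by `s ≤ N`.
    Overlap-align : ∀ {N X Y d u v s} → s ≤ N → u + s ≡ N * X + d → v + s ≡ N * Y →
      SameFactor w (suc C * N) u v → Overlap N X Y d
    Overlap-align {N} {X} {Y} {d} {u} {v} {s} s≤N u+s≡NX+d v+s≡NY same T T< = begin
      w (N * X + d + T)   ≡⟨ cong (λ x → w (x + T)) u+s≡NX+d ⟨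
      w (u + s + T)       ≡⟨ cong w (+-assoc u s T) ⟩
      w (u + (s + T))     ≡⟨ same (s + T) (+-mono-≤-< s≤N T<) ⟩
      w (v + (s + T))     ≡⟨ cong w (+-assoc v s T) ⟨
      w (v + s + T)       ≡⟨ cong (λ x → w (x + T)) v+s≡NY ⟩
      w (N * Y + T)       ∎
      where open ≡-Reasoning

    module _ (M : ℕ) (desubM : Desubstitutes (r ^ M)) where

      desubstitutes : ∀ e → Desubstitutes (r ^ (e + M))
      desubstitutes zero = desubM
      desubstitutes (suc e) = Desubstitutes-suc {{r^m≢0 (e + M)}} (desubstitutes e)

      -- Each desubstitution strips one factor `r` from the offset, and `e` of them are possible
      -- before level `M` is reached.
      r^e∣offset : ∀ e {X Y d} → d < r ^ (e + M) → Overlap (r ^ (e + M)) X Y d → r ^ e ∣ d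
      r^e∣offset zero d< o = 1∣ _
      r^e∣offset (suc e) {X} {Y} {d} d< o with desubstitutes e X Y d d< o
      ... | δ , refl , o′ =
        *-monoʳ-∣ r (r^e∣offset e {X} {Y} (*-cancelˡ-< r δ (r ^ (e + M)) d<) o′)

      -- After the shift by `s`, the later position is `d` modulo `r ^ (e + M)` and the earlier one
      -- is 0. Both are then divisible by `r ^ e`, and so is their difference `D`.
      r^e∣distance : ∀ e i D → SameFactor w (suc C * r ^ (e + M)) (i + D) i → r ^ e ∣ D
      r^e∣distance e i D same with roundUp (r ^ (e + M)) {{r^m≢0 (e + M)}} i
      ... | s , Y , s≤N , i+s≡NY with divide (r ^ (e + M)) {{r^m≢0 (e + M)}} (i + D + s)
      ...   | X , d , d<N , i+D+s≡NX+d = ∣m+n∣m⇒∣n (subst (r ^ e ∣_) sum rᵉ∣left) rᵉ∣right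
        where
        r^e∣N* : ∀ Z → r ^ e ∣ r ^ (e + M) * Z
        r^e∣N* Z = ∣-trans (subst (r ^ e ∣_) (sym (^-distribˡ-+-* r e M)) (m∣m*n (r ^ M))) (m∣m*n Z)

        rᵉ∣left : r ^ e ∣ r ^ (e + M) * X + d
        rᵉ∣left = ∣m∣n⇒∣m+n (r^e∣N* X)
          (r^e∣offset e {X} {Y} d<N
            (Overlap-align {r ^ (e + M)} {X} {Y} {d} s≤N i+D+s≡NX+d i+s≡NY same))

        rᵉ∣right : r ^ e ∣ i + s
        rᵉ∣right = subst (r ^ e ∣_) (sym i+s≡NY) (r^e∣N* Y)

        sum : r ^ (e + M) * X + d ≡ i + s + D
        sum = trans (sym i+D+s≡NX+d) (+-swap i D s)
          where
          +-swap : ∀ a b c → a + b + c ≡ a + c + b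
          +-swap = solve-∀

    returns-divisible : ∃ λ K → ∀ e i D → SameFactor w (r ^ e * K) (i + D) i → r ^ e ∣ D
    returns-divisible = let M , desubM = eventually-desubstitutes in
      -- `K` collects the part of the length `suc C * r ^ (e + M)` that does not depend on `e`.
      suc C * r ^ M , λ e i D same →
        r^e∣distance M desubM e i D (subst (λ l → SameFactor w l (i + D) i) (length≡ M e) same)
      where
      regroup : ∀ a b c → b * (a * c) ≡ a * (b * c)
      regroup = solve-∀
      length≡ : ∀ M e → r ^ e * (suc C * r ^ M) ≡ suc C * r ^ (e + M)
      length≡ M e = trans (regroup (suc C) (r ^ e) (r ^ M))
        (cong (suc C *_) (sym (^-distribˡ-+-* r e M)))

theorem5 : (n r : ℕ) → r ≥ 2 → (μ : UniformMorphism n r) → (a : Fin n) →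
    Prolongable μ a → (w : Word n) → IsFixedPoint μ a w →
    Aperiodic w → UniformlyRecurrent w →
    Σ ℕ λ c → ∀ (k i : ℕ) → k ≥ 1 →
    Σ ℕ λ b → (1 ≤ b) × (b ≤ c * k) × IsAntipower w k b i
theorem5 n r r≥2 μ a _ w fix aper rec =
  -- The bound `n≤1+n` fixes `C` as one more than the recurrence window for letter pairs, so that
  -- `C` is nonzero.
  let K , r^e∣returns = returns-divisible aper rec {{>-nonZero (<⇒≤ r≥2)}} (n≤1+n _)
                          (fixedPoint⇒Inflates r≥2 μ a w fix)
  in linear-antipowers {w = w} K r≥2 r^e∣returns
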